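{- For every integer $k \geq 3$, $\mathcal{G}(\mathcal{P}_{0,1}(2k,1))=0$.
   Context: Toggle: Let $G$ be a finite simple graph, with $N[v]$ the closed neighborhood of $v$. A position $\{G,V_0\}$ consists of $G$ and a set $V_0\subseteq V(G)$ of vertices of weight $0$; all other vertices have weight $1$. Let $\sigma(v)$ be the sum of the weights of the vertices in $N[v]$. A legal move consists of choosing a vertex $v$ of weight $1$ and switching the weight ($0\leftrightarrow 1$) of every vertex of $N[v]$; it is allowed only if $\sigma(v)$ after the switch is strictly smaller than $\sigma(v)$ before it. Two players alternate legal moves; a player with no legal move loses. Nimbers: $\mathcal{G}(\mathcal{S})=\mathrm{mex}\{\mathcal{G}(\mathcal{S}') : \mathcal{S}' \text{ reachable from } \mathcal{S} \text{ by one legal move}\}$, where $\mathrm{mex}(T)$ is the least nonnegative integer not in the finite set $T$ (so $\mathrm{mex}(\emptyset)=0$). The generalized Petersen graph $P(m,1)$ ($m\ge 3$) has inner vertices $v_{0,1},\dots,v_{0,m}$ and outer vertices $v_{1,1},\dots,v_{1,m}$ (second indices modulo $m$), with edges $v_{1,i}v_{1,i+1}$, $v_{0,i}v_{0,i+1}$ and $v_{0,i}v_{1,i}$ for all $i$. $\mathcal{P}_{0,1}(m,1)$ is the position on $P(m,1)$ in which all inner vertices have weight $0$ and all outer vertices have weight $1$. -}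

module Defs where

open import Data.Bool using (true; false; if_then_else_; not)
open import Data.Fin using (Fin; zero; suc; toℕ; remQuot; _≟_)
open import Data.Fin.Properties using (toℕ<n; toℕ-fromℕ<; nonZeroIndex)
open import Data.Fin.Subset using (Subset)
open import Data.List using (List; []; _∷_; map; filter; mapMaybe; allFin)
open import Data.List.Membership.DecPropositional using (_∈?_)
open import Data.List.Membership.Propositional using (_∈_; _∉_)
open import Data.List.Properties using (map-cong)
open import Data.List.Relation.Unary.Any using (here; there)
import Data.Maybe as Maybe
import Data.Nat as ℕ
open import Data.Nat using (ℕ; _+_; _*_; _≤_; _<_; _<?_; s≤s)
open import Data.Nat.DivMod using (_%_; _mod_; m%n<n; m<n⇒m%n≡m; n%n≡0)
open import Data.Nat.Induction using (Acc; acc; <-wellFounded)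
open import Data.Nat.ListAction using (sum)
open import Data.Nat.Properties
  using (+-suc; +-assoc; +-identityʳ; +-monoˡ-<; m≤m+n; m≤n+m; ≤-trans; ≤-refl; <-irrefl;
         m<1+n⇒m<n∨m≡n; 1+n≢n; +-commutativeSemigroup)
open import Algebra.Properties.CommutativeSemigroup +-commutativeSemigroup using (x∙yz≈y∙xz)
open import Data.Product using (_×_; _,_; ∃; proj₁; proj₂)
open import Data.Sum using (_⊎_; inj₁; inj₂; swap; [_,_])
open import Data.Vec using (lookup; tabulate)
open import Data.Vec.Properties using (lookup∘tabulate)
open import Function using (_∘_)
open import Level using (0ℓ)
open import Relation.Binary using (Decidable; Symmetric; Irreflexive)
open import Relation.Binary.PropositionalEquality
  using (_≡_; _≢_; refl; sym; trans; cong; subst; subst₂)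
open import Relation.Nullary using (¬_; Dec; yes; no; does; contradiction)
open import Relation.Nullary.Decidable using (_×-dec_; _⊎-dec_; dec⇒maybe)
open import Relation.Unary using (Pred) renaming (Decidable to Decidable₁)

record Graph : Set₁ where
  field
    order      : ℕ
    Adj        : Fin order → Fin order → Set
    adj?       : Decidable Adj
    adj-sym    : Symmetric Adj
    adj-irrefl : Irreflexive _≡_ Adj

  Vertex : Set
  Vertex = Fin order

  _∈N[_] : Vertex → Vertex → Set
  w ∈N[ v ] = w ≡ v ⊎ Adj v w

  _∈N[_]? : ∀ w v → Dec (w ∈N[ v ])
  w ∈N[ v ]? = (w ≟ v) ⊎-dec adj? v w

open Graph using (order; Vertex)

private
  least : (T : List ℕ) (fuel n : ℕ) → (∀ k → n + fuel ≤ k → k ∉ T) → (∀ k → k < n → k ∈ T) →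
          ∃ λ n → n ∉ T × (∀ k → k < n → k ∈ T)
  least T ℕ.zero n big low =
    n , big n (subst (_≤ n) (sym (+-identityʳ n)) ≤-refl) , low
  least T (ℕ.suc fuel) n big low with _∈?_ ℕ._≟_ n T
  ... | no  n∉T = n , n∉T , low
  ... | yes n∈T = least T fuel (ℕ.suc n) (λ k → big k ∘ subst (_≤ k) (sym (+-suc n fuel))) low′
    where
    low′ : ∀ k → k < ℕ.suc n → k ∈ T
    low′ k k<1+n with m<1+n⇒m<n∨m≡n k<1+n
    ... | inj₁ k<n  = low k k<n
    ... | inj₂ refl = n∈T

  ∈⇒≤sum : ∀ {k} (T : List ℕ) → k ∈ T → k ≤ sum T
  ∈⇒≤sum (x ∷ T) (here refl) = m≤m+n x (sum T)
  ∈⇒≤sum (x ∷ T) (there k∈T) = ≤-trans (∈⇒≤sum T k∈T) (m≤n+m (sum T) x)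

mex-exists : (T : List ℕ) → ∃ λ n → n ∉ T × (∀ k → k < n → k ∈ T)
mex-exists T = least T (ℕ.suc (sum T)) 0
  (λ k Σ<k k∈T → <-irrefl refl (≤-trans Σ<k (∈⇒≤sum T k∈T))) (λ _ ())

mex : List ℕ → ℕ
mex = proj₁ ∘ mex-exists

record Position (G : Graph) : Set where
  constructor position
  field
    V₀ : Subset (order G)

module _ {G : Graph} where

  open Graph G using (_∈N[_]; _∈N[_]?)
  open Position

  weight : Position G → Vertex G → ℕ
  weight S v = if lookup (V₀ S) v then 0 else 1

  σ : Position G → Vertex G → ℕ
  σ S v = sum (map (weight S) (filter (_∈N[ v ]?) (allFin (order G))))

  switch : Position G → Vertex G → Position G
  switch S v .V₀ = tabulate λ w →
    if does (w ∈N[ v ]?) then not (lookup (V₀ S) w) else lookup (V₀ S) w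

  Legal : Position G → Vertex G → Set
  Legal S v = weight S v ≡ 1 × σ (switch S v) v < σ S v

  legal? : ∀ S v → Dec (Legal S v)
  legal? S v = (weight S v ℕ.≟ 1) ×-dec (σ (switch S v) v <? σ S v)

  legalMoves : (S : Position G) → List (∃ (Legal S))
  legalMoves S = mapMaybe (λ v → Maybe.map (v ,_) (dec⇒maybe (legal? S v))) (allFin (order G))

  totalWeight : Position G → ℕ
  totalWeight S = sum (map (weight S) (allFin (order G)))

  private
    split-sums :
      ∀ {A : Set} {P : Pred A 0ℓ} (P? : Decidable₁ P) (f g : A → ℕ) →
      (∀ x → does (P? x) ≡ false → f x ≡ g x) → ∀ xs →
      ∃ λ r → sum (map f xs) ≡ sum (map f (filter P? xs)) + r
            × sum (map g xs) ≡ sum (map g (filter P? xs)) + r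
    split-sums P? f g f≡g [] = 0 , refl , refl
    split-sums P? f g f≡g (x ∷ xs)
      with does (P? x) in eq | split-sums P? f g f≡g xs
    ... | true  | r , p , q =
      r , trans (cong (f x +_) p) (sym (+-assoc (f x) _ r))
        , trans (cong (g x +_) q) (sym (+-assoc (g x) _ r))
    ... | false | r , p , q =
      f x + r
      , trans (cong (f x +_) p) (x∙yz≈y∙xz (f x) _ r)
      , trans (cong (g x +_) q)
          (trans (x∙yz≈y∙xz (g x) _ r)
                 (cong (λ y → sum (map g (filter P? xs)) + (y + r)) (sym (f≡g x eq))))

  switch-decreases : ∀ S v → Legal S v → totalWeight (switch S v) < totalWeight S
  switch-decreases S v (_ , σ↓) =
    let r , p , q = split-sums (_∈N[ v ]?) (weight (switch S v)) (weight S) unchanged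
                      (allFin (order G))
    in  subst₂ _<_ (sym p) (sym q) (+-monoˡ-< r σ↓)
    where
    unchanged : ∀ w → does (w ∈N[ v ]?) ≡ false → weight (switch S v) w ≡ weight S w
    unchanged w eq =
      cong (λ b → if b then 0 else 1)
        (trans (lookup∘tabulate _ w)
               (cong (λ b → if b then not (lookup (V₀ S) w) else lookup (V₀ S) w) eq))

  private
    nimber : (S : Position G) → Acc _<_ (totalWeight S) → ℕ
    nimber S (acc rs) =
      mex (map (λ (v , l) → nimber (switch S v) (rs (switch-decreases S v l))) (legalMoves S))

    nimber-irrelevant : ∀ S (a b : Acc _<_ (totalWeight S)) → nimber S a ≡ nimber S b
    nimber-irrelevant S (acc rs) (acc rs′) = cong mex
      (map-cong (λ (v , l) → nimber-irrelevant (switch S v)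
                               (rs (switch-decreases S v l)) (rs′ (switch-decreases S v l)))
                (legalMoves S))

    nimber-mex : ∀ S (a : Acc _<_ (totalWeight S)) →
      nimber S a ≡ mex (map (λ (v , _) → nimber (switch S v) (<-wellFounded _)) (legalMoves S))
    nimber-mex S (acc rs) = cong mex
      (map-cong (λ (v , l) → nimber-irrelevant (switch S v)
                               (rs (switch-decreases S v l)) (<-wellFounded _))
                (legalMoves S))

  𝒢 : Position G → ℕ
  𝒢 S = nimber S (<-wellFounded (totalWeight S))

  𝒢-mex : ∀ S → 𝒢 S ≡ mex (map (λ (v , _) → 𝒢 (switch S v)) (legalMoves S))
  𝒢-mex S = nimber-mex S (<-wellFounded (totalWeight S))

next : ∀ {m} → Fin m → Fin m
next {m} i = _mod_ (ℕ.suc (toℕ i)) m {{nonZeroIndex i}}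

-- The pair (r , i) stands for v_{r,i}, with residues mod m represented by
-- 0, …, m-1; layer zero is inner and layer suc zero is outer.
Edge : ∀ {m} → Fin 2 × Fin m → Fin 2 × Fin m → Set
Edge (r , i) (s , j) =
  (r ≡ s × j ≡ next i) ⊎ ((r ≡ zero × s ≡ suc zero) × i ≡ j)

edge? : ∀ {m} → Decidable (Edge {m})
edge? (r , i) (s , j) =
  ((r ≟ s) ×-dec (j ≟ next i)) ⊎-dec (((r ≟ zero) ×-dec (s ≟ suc zero)) ×-dec (i ≟ j))

toℕ-next : ∀ {m} (i : Fin m) → toℕ (next i) ≡ _%_ (ℕ.suc (toℕ i)) m {{nonZeroIndex i}}
toℕ-next {m} i = toℕ-fromℕ< (m%n<n (ℕ.suc (toℕ i)) m {{nonZeroIndex i}})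

next≢ : ∀ {m} → 3 ≤ m → (i : Fin m) → i ≢ next i
next≢ {m} 3≤m i i≡next with m<1+n⇒m<n∨m≡n (s≤s (toℕ<n i))
... | inj₁ 1+i<m = 1+n≢n (sym (trans (cong toℕ i≡next) (trans (toℕ-next i) (m<n⇒m%n≡m {{nonZeroIndex i}} 1+i<m))))
... | inj₂ 1+i≡m = contradiction (subst (3 ≤_) m≡1 3≤m) λ { (s≤s ()) }
  where
  toℕi≡0 : toℕ i ≡ 0
  toℕi≡0 = trans (cong toℕ i≡next) (trans (toℕ-next i)
    (trans (cong (λ x → _%_ x m {{nonZeroIndex i}}) 1+i≡m) (n%n≡0 m {{nonZeroIndex i}})))
  m≡1 : m ≡ 1
  m≡1 = trans (sym 1+i≡m) (cong ℕ.suc toℕi≡0)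

edge-irrefl : ∀ {m} → 3 ≤ m → (u : Fin 2 × Fin m) → ¬ Edge u u
edge-irrefl 3≤m (_ , i) (inj₁ (_ , i≡next))    = next≢ 3≤m i i≡next
edge-irrefl 3≤m _       (inj₂ ((refl , ()) , _))

-- Vertex v_{r,i} is encoded as `combine r i`, the inverse of `remQuot m`.
P[_,1] : (m : ℕ) → 3 ≤ m → Graph
P[ m ,1] 3≤m = record
  { order      = 2 * m
  ; Adj        = λ x y → Edge (vertex x) (vertex y) ⊎ Edge (vertex y) (vertex x)
  ; adj?       = λ x y → edge? (vertex x) (vertex y) ⊎-dec edge? (vertex y) (vertex x)
  ; adj-sym    = swap
  ; adj-irrefl = λ { {x} refl → [ edge-irrefl 3≤m (vertex x) , edge-irrefl 3≤m (vertex x) ] }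
  }
  where
  vertex : Fin (2 * m) → Fin 2 × Fin m
  vertex = remQuot m

𝒫₀₁ : (m : ℕ) (3≤m : 3 ≤ m) → Position (P[ m ,1] 3≤m)
𝒫₀₁ m _ = position (tabulate λ x → does (proj₁ (remQuot {2} m x) ≟ zero))

{-# OPTIONS --safe #-}

-- The second player answers each move v with ρ v, where ρ is the rotation of
-- P(2k,1) by k.  As k ≥ 3, the closed neighbourhoods N[v] and N[ρ v] are disjoint,
-- so switching N[v] does not affect the legality of ρ v; the two moves together
-- restore invariance under ρ.  Hence every ρ-invariant position has nimber 0.
module Submission where

open import Defs
open import Data.Bool using (true; false; not; if_then_else_; _xor_)
open import Data.Bool.Properties using (xor-assoc; xor-comm)
open import Data.Fin using (Fin; zero; toℕ; combine; remQuot; _≟_)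
open import Data.Fin.Properties using (toℕ<n; toℕ-injective; remQuot-combine; combine-remQuot)
open import Data.List using (List; map; filter; allFin)
open import Data.List.Membership.Propositional using (_∈_; _∉_)
open import Data.List.Membership.Propositional.Properties using (∈-map⁺; ∈-map⁻; ∈-filter⁺; ∈-filter⁻; ∈-allFin)
open import Data.List.Membership.Propositional.Properties.WithK using (unique∧set⇒bag)
open import Data.List.Properties using (map-∘; map-cong-local)
open import Data.List.Relation.Binary.BagAndSetEquality using (∼bag⇒↭)
open import Data.List.Relation.Binary.Permutation.Propositional using (_↭_)
import Data.List.Relation.Binary.Permutation.Propositional.Properties as ↭
import Data.List.Relation.Unary.All as All
open import Data.List.Relation.Unary.All.Properties using (all-filter)
import Data.List.Relation.Unary.Any as Any
import Data.List.Relation.Unary.Any.Properties as Any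
open import Data.List.Relation.Unary.Unique.Propositional.Properties using (map⁺; filter⁺; allFin⁺)
import Data.Maybe as Maybe
import Data.Maybe.Relation.Unary.Any as MAny
open import Data.Nat using (ℕ; suc; _+_; _∸_; _*_; _≤_; _<_; _<?_; z<s; s<s; NonZero; >-nonZero)
open import Data.Nat.DivMod using (_%_; %-congˡ; m<n⇒m%n≡m; m≤n⇒[n∸m]%m≡n%m; %-distribˡ-+; m%n%n≡m%n; [m+n]%n≡m%n)
open import Data.Nat.GeneralisedArithmetic using (fold; fold-+)
open import Data.Nat.Induction using (Acc; acc; <-wellFounded)
open import Data.Nat.ListAction using (sum)
open import Data.Nat.ListAction.Properties using (sum-↭)
open import Data.Nat.Properties using (≤-trans; <-trans; ≤-<-trans; <-≤-trans; <⇒≢; <⇒≤; ≮⇒≥; m≤n*m; +-comm; +-identityʳ; +-monoˡ-<; ∸-monoˡ-<; m+n∸m≡n; m∸n+n≡m; m∸n≤m; m<n+m; m<m+n; m<n⇒0<n∸m)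
open import Data.Product using (_×_; _,_; proj₁; proj₂; uncurry; map₂)
open import Data.Sum using (_⊎_; inj₁; inj₂)
import Data.Sum as Sum
open import Data.Vec using (lookup)
open import Data.Vec.Properties using (lookup∘tabulate)
open import Function using (_∘_; mk⇔)
open import Relation.Binary.PropositionalEquality
open import Relation.Nullary using (¬_; Dec; yes; no; does; contradiction)
open import Relation.Nullary.Decidable using (dec⇒maybe; dec-true; dec-false; does-⇔)

open Position using (V₀)

-- Nimber zero as a loss for the player to move.

mex≡0 : ∀ T → 0 ∉ T → mex T ≡ 0
mex≡0 T 0∉T with mex-exists T
... | 0     , _         = refl
... | suc _ , _ , below = contradiction (below 0 z<s) 0∉T

mex≢0 : ∀ T → 0 ∈ T → mex T ≢ 0
mex≢0 T 0∈T eq = proj₁ (proj₂ (mex-exists T)) (subst (_∈ T) (sym eq) 0∈T)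

module _ {G : Graph} where

  open Graph G using (Vertex; order; _∈N[_]; _∈N[_]?)

  -- With `xor` in place of the conditional, successive switches combine by associativity and
  -- commutativity.
  lookup-switch : ∀ (S : Position G) v w →
    lookup (V₀ (switch S v)) w ≡ does (w ∈N[ v ]?) xor lookup (V₀ S) w
  lookup-switch S v w = trans (lookup∘tabulate _ w) (if-xor (does (w ∈N[ v ]?)) _)
    where
    if-xor : ∀ b c → (if b then not c else c) ≡ b xor c
    if-xor true  _ = refl
    if-xor false _ = refl

  options : Position G → List ℕ
  options S = map (λ (v , _) → 𝒢 (switch S v)) (legalMoves S)

  legal⇒∈options : ∀ S {v} → Legal S v → 𝒢 (switch S v) ∈ options S
  legal⇒∈options S {v} l =
    Any.map⁺ (Any.mapMaybe⁺ _ (allFin order)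
      (Any.map⁺ (Any.map (λ { refl → found (legal? S v) }) (∈-allFin v))))
    where
    -- The list stores whichever proof `legal? S v` returns, which need not be `l`; the resulting
    -- nimber depends on `v` alone.
    found : (l? : Dec (Legal S v)) →
      MAny.Any (λ (u , _) → 𝒢 (switch S v) ≡ 𝒢 (switch S u)) (Maybe.map (v ,_) (dec⇒maybe l?))
    found (yes _) = MAny.just refl
    found (no ¬l) = contradiction l ¬l

  𝒢≡0 : ∀ S → (∀ v → Legal S v → 𝒢 (switch S v) ≢ 0) → 𝒢 S ≡ 0
  𝒢≡0 S options≢0 = trans (𝒢-mex S) (mex≡0 (options S) λ 0∈ →
    let (v , l) , _ , 0≡ = ∈-map⁻ (λ (v , _) → 𝒢 (switch S v)) {xs = legalMoves S} 0∈
    in  options≢0 v l (sym 0≡))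

  𝒢≢0 : ∀ S {v} → Legal S v → 𝒢 (switch S v) ≡ 0 → 𝒢 S ≢ 0
  𝒢≢0 S l 𝒢≡0 eq =
    mex≢0 (options S) (subst (_∈ options S) 𝒢≡0 (legal⇒∈options S l)) (trans (sym (𝒢-mex S)) eq)

  -- The pairing strategy for an involution that moves closed neighbourhoods off themselves.

  module Pairing
    (ρ : Vertex → Vertex)
    (ρ-involutive : ∀ v → ρ (ρ v) ≡ v)
    (ρ-∈N : ∀ {v w} → w ∈N[ v ] → ρ w ∈N[ ρ v ])
    (N-disjoint : ∀ {v w} → w ∈N[ v ] → ¬ w ∈N[ ρ v ])
    where

    Invariant : Position G → Set
    Invariant S = ∀ v → lookup (V₀ S) (ρ v) ≡ lookup (V₀ S) v

    ρ-injective : ∀ {v w} → ρ v ≡ ρ w → v ≡ w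
    ρ-injective {v} {w} eq = trans (sym (ρ-involutive v)) (trans (cong ρ eq) (ρ-involutive w))

    ∈N-swapˡ : ∀ {v w} → ρ w ∈N[ v ] → w ∈N[ ρ v ]
    ∈N-swapˡ {v} {w} = subst (_∈N[ ρ v ]) (ρ-involutive w) ∘ ρ-∈N

    ∈N-swapʳ : ∀ {v w} → w ∈N[ ρ v ] → ρ w ∈N[ v ]
    ∈N-swapʳ {v} {w} = subst (ρ w ∈N[_]) (ρ-involutive v) ∘ ρ-∈N

    does-∈N-swap : ∀ v w → does (ρ w ∈N[ v ]?) ≡ does (w ∈N[ ρ v ]?)
    does-∈N-swap v w = does-⇔ (mk⇔ ∈N-swapˡ ∈N-swapʳ) (ρ w ∈N[ v ]?) (w ∈N[ ρ v ]?)

    N : Vertex → List Vertex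
    N v = filter (_∈N[ v ]?) (allFin order)

    ∈N⁺ : ∀ {v w} → w ∈N[ v ] → w ∈ N v
    ∈N⁺ {v} {w} = ∈-filter⁺ (_∈N[ v ]?) (∈-allFin w)

    ∈N⁻ : ∀ {v w} → w ∈ N v → w ∈N[ v ]
    ∈N⁻ {v} = proj₂ ∘ ∈-filter⁻ (_∈N[ v ]?) {xs = allFin order}

    -- Both lists are duplicate-free and have the same members, hence equal as bags. `ρ` need not
    -- respect the order of `allFin`, but a permutation is enough for the sums in `σ`.
    N-ρ : ∀ v → N (ρ v) ↭ map ρ (N v)
    N-ρ v = ∼bag⇒↭ (unique∧set⇒bag
      (filter⁺ (_∈N[ ρ v ]?) (allFin⁺ order))
      (map⁺ ρ-injective (filter⁺ (_∈N[ v ]?) (allFin⁺ order)))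
      (mk⇔ to from))
      where
      to : ∀ {w} → w ∈ N (ρ v) → w ∈ map ρ (N v)
      to {w} w∈ = subst (_∈ map ρ (N v)) (ρ-involutive w) (∈-map⁺ ρ (∈N⁺ (∈N-swapʳ (∈N⁻ w∈))))
      from : ∀ {w} → w ∈ map ρ (N v) → w ∈ N (ρ v)
      from w∈ with u , u∈ , refl ← ∈-map⁻ ρ {xs = N v} w∈ = ∈N⁺ (ρ-∈N (∈N⁻ u∈))

    weight-cong : ∀ (S T : Position G) {u w} →
      lookup (V₀ S) u ≡ lookup (V₀ T) w → weight S u ≡ weight T w
    weight-cong _ _ = cong (λ b → if b then 0 else 1)

    -- Two independent positions are allowed so that one lemma serves both sides of the legality
    -- inequality: `S`, `S′` before the reply and `S′`, `S″` after it.
    σ-ρ : ∀ (S T : Position G) v →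
      (∀ {w} → w ∈N[ v ] → lookup (V₀ T) (ρ w) ≡ lookup (V₀ S) w) → σ T (ρ v) ≡ σ S v
    σ-ρ S T v same = begin
      sum (map (weight T) (N (ρ v)))      ≡⟨ sum-↭ (↭.map⁺ (weight T) (N-ρ v)) ⟩
      sum (map (weight T) (map ρ (N v)))  ≡⟨ cong sum (map-∘ (N v)) ⟨
      sum (map (weight T ∘ ρ) (N v))      ≡⟨ cong sum (map-cong-local
                                               (All.map (weight-cong T S ∘ same)
                                                 (all-filter (_∈N[ v ]?) (allFin order)))) ⟩
      sum (map (weight S) (N v))          ∎
      where open ≡-Reasoning

    module _ (S : Position G) (invariant : Invariant S) (v : Vertex) where

      S′ S″ : Position G
      S′ = switch S v
      S″ = switch S′ (ρ v)

      -- The vertex `ρ w` lies in `N[ρ v]`, so by disjointness the first move leaves it alone, and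
      -- invariance of `S` does the rest.
      switch-ρ : ∀ {w} → w ∈N[ v ] → lookup (V₀ S′) (ρ w) ≡ lookup (V₀ S) w
      switch-ρ {w} w∈ = begin
        lookup (V₀ S′) (ρ w)                         ≡⟨ lookup-switch S v (ρ w) ⟩
        does (ρ w ∈N[ v ]?) xor lookup (V₀ S) (ρ w)  ≡⟨ cong (_xor lookup (V₀ S) (ρ w)) (dec-false (ρ w ∈N[ v ]?) λ ρw∈ → N-disjoint ρw∈ (ρ-∈N w∈)) ⟩
        lookup (V₀ S) (ρ w)                          ≡⟨ invariant w ⟩
        lookup (V₀ S) w                              ∎
        where open ≡-Reasoning

      -- The reply flips `ρ w`, untouched until then, just as the first move flipped `w`.
      switch²-ρ : ∀ {w} → w ∈N[ v ] → lookup (V₀ S″) (ρ w) ≡ lookup (V₀ S′) w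
      switch²-ρ {w} w∈ = begin
        lookup (V₀ S″) (ρ w)                            ≡⟨ lookup-switch S′ (ρ v) (ρ w) ⟩
        does (ρ w ∈N[ ρ v ]?) xor lookup (V₀ S′) (ρ w)  ≡⟨ cong₂ _xor_ (dec-true (ρ w ∈N[ ρ v ]?) (ρ-∈N w∈)) (switch-ρ w∈) ⟩
        not (lookup (V₀ S) w)                           ≡⟨ cong (_xor lookup (V₀ S) w) (dec-true (w ∈N[ v ]?) w∈) ⟨
        does (w ∈N[ v ]?) xor lookup (V₀ S) w           ≡⟨ lookup-switch S v w ⟨
        lookup (V₀ S′) w                                ∎
        where open ≡-Reasoning

      reply-legal : Legal S v → Legal S′ (ρ v)
      reply-legal (weight≡1 , σ↓) =
          trans (weight-cong S′ S (switch-ρ (inj₁ refl))) weight≡1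
        , subst₂ _<_ (sym (σ-ρ S′ S″ v switch²-ρ)) (sym (σ-ρ S S′ v switch-ρ)) σ↓

      -- Applying `ρ` exchanges the indicators of `N[v]` and `N[ρ v]`, and the order of two switches
      -- is immaterial.
      reply-invariant : Invariant S″
      reply-invariant w = begin
        lookup (V₀ S″) (ρ w)
          ≡⟨ expand (ρ w) ⟩
        does (ρ w ∈N[ ρ v ]?) xor (does (ρ w ∈N[ v ]?) xor lookup (V₀ S) (ρ w))
          ≡⟨ cong₂ _xor_ (trans (does-∈N-swap (ρ v) w) (cong (λ u → does (w ∈N[ u ]?)) (ρ-involutive v)))
                         (cong₂ _xor_ (does-∈N-swap v w) (invariant w)) ⟩
        does (w ∈N[ v ]?) xor (does (w ∈N[ ρ v ]?) xor lookup (V₀ S) w)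
          ≡⟨ x∙yz≈y∙xz (does (w ∈N[ v ]?)) (does (w ∈N[ ρ v ]?)) (lookup (V₀ S) w) ⟩
        does (w ∈N[ ρ v ]?) xor (does (w ∈N[ v ]?) xor lookup (V₀ S) w)
          ≡⟨ expand w ⟨
        lookup (V₀ S″) w ∎
        where
        open ≡-Reasoning
        expand : ∀ w → lookup (V₀ S″) w ≡
                 does (w ∈N[ ρ v ]?) xor (does (w ∈N[ v ]?) xor lookup (V₀ S) w)
        expand w = trans (lookup-switch S′ (ρ v) w)
                         (cong (does (w ∈N[ ρ v ]?) xor_) (lookup-switch S v w))
        x∙yz≈y∙xz : ∀ x y z → x xor (y xor z) ≡ y xor (x xor z)
        x∙yz≈y∙xz x y z = trans (sym (xor-assoc x y z))
          (trans (cong (_xor z) (xor-comm x y)) (xor-assoc y x z))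

    -- Well-founded induction on total weight, one round (move and reply) at a time: the round ends
    -- in a lighter invariant position of nimber 0, so the position between the two moves has
    -- nonzero nimber.
    invariant⇒𝒢≡0 : ∀ S → Invariant S → 𝒢 S ≡ 0
    invariant⇒𝒢≡0 S = go S (<-wellFounded (totalWeight S))
      where
      go : ∀ S → Acc _<_ (totalWeight S) → Invariant S → 𝒢 S ≡ 0
      go S (acc rs) inv = 𝒢≡0 S λ v l →
        let l′ = reply-legal S inv v l
        in  𝒢≢0 (switch S v) l′
              (go (switch (switch S v) (ρ v))
                  (rs (<-trans (switch-decreases (switch S v) (ρ v) l′) (switch-decreases S v l)))
                  (reply-invariant S inv v))

-- Rotations of the cycle of residues.

rotate : ∀ {m} → ℕ → Fin m → Fin m
rotate n i = fold i next n

module _ {m} .{{_ : NonZero m}} where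

  -- Iterating `next` makes composition of rotations an instance of `fold-+`; the arithmetic formula
  -- serves to decide which rotations have fixed points.
  toℕ-rotate : ∀ n (i : Fin m) → toℕ (rotate n i) ≡ (n + toℕ i) % m
  toℕ-rotate 0       i = sym (m<n⇒m%n≡m (toℕ<n i))
  toℕ-rotate (suc n) i = begin
    toℕ (next (rotate n i))            ≡⟨ toℕ-next-% (rotate n i) ⟩
    suc (toℕ (rotate n i)) % m         ≡⟨ %-congˡ (cong suc (toℕ-rotate n i)) ⟩
    suc ((n + toℕ i) % m) % m          ≡⟨ %-distribˡ-+ 1 ((n + toℕ i) % m) m ⟩
    (1 % m + (n + toℕ i) % m % m) % m  ≡⟨ cong (λ x → (1 % m + x) % m) (m%n%n≡m%n (n + toℕ i) m) ⟩
    (1 % m + (n + toℕ i) % m) % m      ≡⟨ %-distribˡ-+ 1 (n + toℕ i) m ⟨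
    suc (n + toℕ i) % m                ∎
    where
    open ≡-Reasoning
    -- The `NonZero` argument of `_%_` is irrelevant, so changing the instance leaves the type of
    -- `toℕ-next` definitionally the same.
    toℕ-next-% : ∀ (j : Fin m) → toℕ (next j) ≡ suc (toℕ j) % m
    toℕ-next-% = toℕ-next

  rotate-full : ∀ (i : Fin m) → rotate m i ≡ i
  rotate-full i = toℕ-injective (begin
    toℕ (rotate m i)  ≡⟨ toℕ-rotate m i ⟩
    (m + toℕ i) % m   ≡⟨ cong (_% m) (+-comm m (toℕ i)) ⟩
    (toℕ i + m) % m   ≡⟨ [m+n]%n≡m%n (toℕ i) m ⟩
    toℕ i % m         ≡⟨ m<n⇒m%n≡m (toℕ<n i) ⟩
    toℕ i             ∎)
    where open ≡-Reasoning

  -- Without wrapping, the value exceeds `toℕ i`; with wrapping, it drops to `n + toℕ i ∸ m`, which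
  -- is below `toℕ i`.
  rotate≢ : ∀ {n} → 0 < n → n < m → (i : Fin m) → rotate n i ≢ i
  rotate≢ {n} 0<n n<m i eq with n + toℕ i <? m
  ... | yes n+i<m = <⇒≢ (m<n+m (toℕ i) 0<n) (begin
    toℕ i             ≡⟨ cong toℕ eq ⟨
    toℕ (rotate n i)  ≡⟨ toℕ-rotate n i ⟩
    (n + toℕ i) % m   ≡⟨ m<n⇒m%n≡m n+i<m ⟩
    n + toℕ i         ∎)
    where open ≡-Reasoning
  ... | no  n+i≮m = <⇒≢ n+i∸m<i (begin
    n + toℕ i ∸ m        ≡⟨ m<n⇒m%n≡m (<-trans n+i∸m<i (toℕ<n i)) ⟨
    (n + toℕ i ∸ m) % m  ≡⟨ m≤n⇒[n∸m]%m≡n%m (≮⇒≥ n+i≮m) ⟩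
    (n + toℕ i) % m      ≡⟨ toℕ-rotate n i ⟨
    toℕ (rotate n i)     ≡⟨ cong toℕ eq ⟩
    toℕ i                ∎)
    where
    open ≡-Reasoning
    n+i∸m<i : n + toℕ i ∸ m < toℕ i
    n+i∸m<i = subst (n + toℕ i ∸ m <_) (m+n∸m≡n m (toℕ i))
                (∸-monoˡ-< (+-monoˡ-< (toℕ i) n<m) (≮⇒≥ n+i≮m))

-- The half-turn of the prism `P[ 2 * k ,1]`.

module Antipode (k : ℕ) (3≤k : 3 ≤ k) (3≤2k : 3 ≤ 2 * k) where

  open Graph (P[ 2 * k ,1] 3≤2k) using (_∈N[_])

  instance
    2k≢0 : NonZero (2 * k)
    2k≢0 = >-nonZero (≤-trans z<s 3≤2k)

  k<2k : k < 2 * k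
  -- `2 * k` unfolds to `k + (k + 0)`.
  k<2k = m<m+n k (subst (0 <_) (sym (+-identityʳ k)) (≤-trans z<s 3≤k))

  opposite : Fin (2 * k) → Fin (2 * k)
  opposite = rotate k

  opposite-next : ∀ i → opposite (next i) ≡ next (opposite i)
  -- Both sides are `k + 1` iterations of `next`.
  opposite-next i = trans (sym (fold-+ i next k)) (cong (fold i next) (+-comm k 1))

  opposite-involutive : ∀ i → opposite (opposite i) ≡ i
  opposite-involutive i = begin
    rotate k (rotate k i)  ≡⟨ fold-+ i next k ⟨
    rotate (k + k) i       ≡⟨ cong (λ n → rotate (k + n) i) (+-identityʳ k) ⟨
    rotate (2 * k) i       ≡⟨ rotate-full i ⟩
    i                      ∎
    where open ≡-Reasoning

  -- Otherwise rotation by `k ∸ a` would fix `rotate a i`, although `3 ≤ k` puts `k ∸ a` strictly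
  -- between 0 and `2 * k`.
  opposite≢rotate : ∀ {a} → a < 3 → ∀ i → opposite i ≢ rotate a i
  opposite≢rotate {a} a<3 i eq =
    rotate≢ (m<n⇒0<n∸m a<k) (≤-<-trans (m∸n≤m k a) k<2k) (rotate a i) (begin
      rotate (k ∸ a) (rotate a i)  ≡⟨ fold-+ i next (k ∸ a) ⟨
      rotate (k ∸ a + a) i         ≡⟨ cong (λ n → rotate n i) (m∸n+n≡m (<⇒≤ a<k)) ⟩
      opposite i                   ≡⟨ eq ⟩
      rotate a i                   ∎)
    where
    open ≡-Reasoning
    a<k : a < k
    a<k = <-≤-trans a<3 3≤k

  rotate-opposite≢ : ∀ {a} → a < 3 → ∀ i → i ≢ rotate a (opposite i)
  rotate-opposite≢ a<3 i eq =
    opposite≢rotate a<3 (opposite i) (trans (opposite-involutive i) eq)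

  -- The shadow of a closed neighbourhood on the second index. Rungs keep the index, and forgetting
  -- the layer still separates `N[v]` from `N[ρ v]`.
  Near : Fin (2 * k) → Fin (2 * k) → Set
  Near i j = j ≡ i ⊎ (j ≡ next i ⊎ i ≡ next j)

  -- A common `j` would put `i` and `opposite i` at cyclic distance at most 2. The nine cases pair
  -- the offsets of `j` from each.
  near-disjoint : ∀ {i j} → Near i j → ¬ Near (opposite i) j
  near-disjoint {i} (inj₁ j≡i) (inj₁ j≡oi) =
    opposite≢rotate {0} z<s i (trans (sym j≡oi) j≡i)
  near-disjoint {i} (inj₁ j≡i) (inj₂ (inj₁ j≡noi)) =
    rotate-opposite≢ {1} (s<s z<s) i (trans (sym j≡i) j≡noi)
  near-disjoint {i} (inj₁ j≡i) (inj₂ (inj₂ oi≡nj)) =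
    opposite≢rotate {1} (s<s z<s) i (trans oi≡nj (cong next j≡i))
  near-disjoint {i} (inj₂ (inj₁ j≡ni)) (inj₁ j≡oi) =
    opposite≢rotate {1} (s<s z<s) i (trans (sym j≡oi) j≡ni)
  near-disjoint {i} (inj₂ (inj₁ j≡ni)) (inj₂ (inj₁ j≡noi)) =
    -- Equal offsets: `next i` would be its own opposite.
    opposite≢rotate {0} z<s (next i) (trans (opposite-next i) (trans (sym j≡noi) j≡ni))
  near-disjoint {i} (inj₂ (inj₁ j≡ni)) (inj₂ (inj₂ oi≡nj)) =
    opposite≢rotate {2} (s<s (s<s z<s)) i (trans oi≡nj (cong next j≡ni))
  near-disjoint {i} (inj₂ (inj₂ i≡nj)) (inj₁ j≡oi) =
    rotate-opposite≢ {1} (s<s z<s) i (trans i≡nj (cong next j≡oi))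
  near-disjoint {i} (inj₂ (inj₂ i≡nj)) (inj₂ (inj₁ j≡noi)) =
    rotate-opposite≢ {2} (s<s (s<s z<s)) i (trans i≡nj (cong next j≡noi))
  near-disjoint {i} (inj₂ (inj₂ i≡nj)) (inj₂ (inj₂ oi≡nj)) =
    opposite≢rotate {0} z<s i (trans oi≡nj (sym i≡nj))

  vertex : Fin (2 * (2 * k)) → Fin 2 × Fin (2 * k)
  vertex = remQuot (2 * k)

  ρ : Fin (2 * (2 * k)) → Fin (2 * (2 * k))
  ρ = uncurry combine ∘ map₂ opposite ∘ vertex

  vertex-ρ : ∀ v → vertex (ρ v) ≡ map₂ opposite (vertex v)
  vertex-ρ v = uncurry remQuot-combine (map₂ opposite (vertex v))

  ρ-involutive : ∀ v → ρ (ρ v) ≡ v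
  ρ-involutive v = begin
    uncurry combine (map₂ opposite (vertex (ρ v)))           ≡⟨ cong (uncurry combine ∘ map₂ opposite) (vertex-ρ v) ⟩
    uncurry combine (map₂ (opposite ∘ opposite) (vertex v))  ≡⟨ cong (combine (proj₁ (vertex v))) (opposite-involutive _) ⟩
    uncurry combine (vertex v)                               ≡⟨ combine-remQuot {2} (2 * k) v ⟩
    v                                                        ∎
    where open ≡-Reasoning

  edge-opposite : ∀ {u w : Fin 2 × Fin (2 * k)} →
    Edge u w → Edge (map₂ opposite u) (map₂ opposite w)
  edge-opposite {_ , i} (inj₁ (r≡s , j≡ni))   = inj₁ (r≡s , trans (cong opposite j≡ni) (opposite-next i))
  edge-opposite         (inj₂ (layers , i≡j)) = inj₂ (layers , cong opposite i≡j)

  edge-ρ : ∀ v w → Edge (vertex v) (vertex w) → Edge (vertex (ρ v)) (vertex (ρ w))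
  edge-ρ v w e = subst₂ Edge (sym (vertex-ρ v)) (sym (vertex-ρ w)) (edge-opposite e)

  ρ-∈N : ∀ {v w} → w ∈N[ v ] → ρ w ∈N[ ρ v ]
  ρ-∈N {v} {w} = Sum.map (cong ρ) (Sum.map (edge-ρ v w) (edge-ρ w v))

  ∈N⇒near : ∀ v w → w ∈N[ v ] → Near (proj₂ (vertex v)) (proj₂ (vertex w))
  ∈N⇒near v w (inj₁ w≡v)                  = inj₁ (cong (proj₂ ∘ vertex) w≡v)
  ∈N⇒near v w (inj₂ (inj₁ (inj₁ (_ , eq)))) = inj₂ (inj₁ eq)
  ∈N⇒near v w (inj₂ (inj₁ (inj₂ (_ , eq)))) = inj₁ (sym eq)
  ∈N⇒near v w (inj₂ (inj₂ (inj₁ (_ , eq)))) = inj₂ (inj₂ eq)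
  ∈N⇒near v w (inj₂ (inj₂ (inj₂ (_ , eq)))) = inj₁ eq

  N-disjoint : ∀ {v w} → w ∈N[ v ] → ¬ w ∈N[ ρ v ]
  N-disjoint {v} {w} w∈Nv w∈Nρv = near-disjoint (∈N⇒near v w w∈Nv)
    (subst (λ u → Near (proj₂ u) (proj₂ (vertex w))) (vertex-ρ v) (∈N⇒near (ρ v) w w∈Nρv))

  open Pairing {P[ 2 * k ,1] 3≤2k} ρ ρ-involutive (λ {v} {w} → ρ-∈N {v} {w}) (λ {v} {w} → N-disjoint {v} {w}) public

  𝒫₀₁-invariant : Invariant (𝒫₀₁ (2 * k) 3≤2k)
  𝒫₀₁-invariant v = begin
    lookup (V₀ (𝒫₀₁ (2 * k) 3≤2k)) (ρ v)  ≡⟨ lookup∘tabulate _ (ρ v) ⟩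
    does (proj₁ (vertex (ρ v)) ≟ zero)    ≡⟨ cong (λ u → does (proj₁ u ≟ zero)) (vertex-ρ v) ⟩
    does (proj₁ (vertex v) ≟ zero)        ≡⟨ lookup∘tabulate _ v ⟨
    lookup (V₀ (𝒫₀₁ (2 * k) 3≤2k)) v      ∎
    where open ≡-Reasoning

theorem4p10 : (k : ℕ) (3≤k : 3 ≤ k) → 𝒢 (𝒫₀₁ (2 * k) (≤-trans 3≤k (m≤n*m k 2))) ≡ 0
theorem4p10 k 3≤k = invariant⇒𝒢≡0 (𝒫₀₁ (2 * k) 3≤2k) 𝒫₀₁-invariant
  where
  3≤2k : 3 ≤ 2 * k
  3≤2k = ≤-trans 3≤k (m≤n*m k 2)
  open Antipode k 3≤k 3≤2k
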